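{- Isomorphism is strictly finer than strong bisimilarity: for every parity game and all its vertices $v,w$, if $v$ and $w$ are isomorphic then they are strongly bisimilar; and there exists a parity game with vertices $v,w$ that are strongly bisimilar but not isomorphic.
   Context: A parity game is a tuple $(V,\to,\Omega,\mathcal P)$ where $V$ is a finite set of vertices, $\to\subseteq V\times V$ is total (every vertex has at least one successor), $\Omega:V\to\mathbb N$ is a priority function, and $\mathcal P:V\to\{\Diamond,\Box\}$ assigns each vertex to player even ($\Diamond$) or odd ($\Box$). Write $v^\bullet=\{w\mid v\to w\}$. Vertices $v,w\in V$ are isomorphic iff $\phi(v)=w$ for some bijection $\phi:V\to V$ such that for all $u,u'\in V$: $\Omega(u)=\Omega(\phi(u))$, $\mathcal P(u)=\mathcal P(\phi(u))$, and $u\to u'$ iff $\phi(u)\to\phi(u')$. A symmetric relation $R\subseteq V\times V$ is a governed bisimulation iff $v\,R\,w$ implies: (1) $\Omega(v)=\Omega(w)$; (2) if $\mathcal P(v)\neq\mathcal P(w)$, then $v'\,R\,w'$ for all $v'\in v^\bullet$ and $w'\in w^\bullet$; (3) for all $v'\in v^\bullet$ there is some $w'\in w^\bullet$ with $v'\,R\,w'$. A strong bisimulation is a governed bisimulation $R$ that does not relate vertices owned by different players ($v\,R\,w$ implies $\mathcal P(v)=\mathcal P(w)$). Vertices are strongly bisimilar iff some strong bisimulation relates them. -}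

module Defs where

open import Data.Fin.Base using (Fin)
open import Data.Nat.Base using (ℕ)
open import Data.Product.Base using (Σ; ∃; _×_)
open import Function.Bundles using (_⤖_; _⇔_; module Bijection)
open import Level using (0ℓ)
open import Relation.Binary.Core using (Rel)
open import Relation.Binary.Definitions using (Symmetric)
open import Relation.Binary.PropositionalEquality.Core using (_≡_; _≢_)

data Player : Set where
  ◇ □ : Player

-- Finiteness of V is a bijection with some Fin n.  The edge relation is
-- an arbitrary relation: decidability is not assumed.
record ParityGame : Set₁ where
  infix 4 _⟶_
  field
    V      : Set
    finite : ∃ λ n → V ⤖ Fin n
    _⟶_    : Rel V 0ℓ
    total  : ∀ v → ∃ λ w → v ⟶ w
    Ω      : V → ℕ
    𝒫      : V → Player

module _ (G : ParityGame) where
  open ParityGame G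

  record IsAutomorphism (φ : V → V) : Set where
    field
      priority : ∀ u → Ω u ≡ Ω (φ u)
      player   : ∀ u → 𝒫 u ≡ 𝒫 (φ u)
      edge     : ∀ u u′ → (u ⟶ u′) ⇔ (φ u ⟶ φ u′)

  Isomorphic : Rel V 0ℓ
  Isomorphic v w =
    Σ (V ⤖ V) λ φ → IsAutomorphism (Bijection.to φ) × Bijection.to φ v ≡ w

  record IsGovernedBisimulation (R : Rel V 0ℓ) : Set where
    field
      symmetric : Symmetric R
      priority  : ∀ {v w} → R v w → Ω v ≡ Ω w
      governed  : ∀ {v w} → R v w → 𝒫 v ≢ 𝒫 w →
                  ∀ v′ w′ → v ⟶ v′ → w ⟶ w′ → R v′ w′
      transfer  : ∀ {v w} → R v w →
                  ∀ v′ → v ⟶ v′ → ∃ λ w′ → w ⟶ w′ × R v′ w′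

  record IsStrongBisimulation (R : Rel V 0ℓ) : Set where
    field
      isGovernedBisimulation : IsGovernedBisimulation R
      player                 : ∀ {v w} → R v w → 𝒫 v ≡ 𝒫 w

  StronglyBisimilar : V → V → Set₁
  StronglyBisimilar v w = ∃ λ R → IsStrongBisimulation R × R v w

{-# OPTIONS --safe #-}
module Submission where

open import Defs
open import Data.Fin.Base using (Fin; zero; suc)
open import Data.Product.Base using (∃; ∃₂; _×_; _,_)
open import Data.Sum.Base using (_⊎_; inj₁; inj₂; swap)
open import Data.Unit.Base using (⊤; tt)
open import Function.Base using (const)
open import Function.Bundles using (_⤖_; module Bijection; module Equivalence)
open import Function.Construct.Identity using (⤖-id)
open import Relation.Binary.Core using (Rel)
open import Relation.Binary.PropositionalEquality.Core using (_≡_; refl; sym)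
open import Relation.Nullary.Negation.Core using (¬_; contradiction)
open import Level using (0ℓ)

-- The symmetric closure of the graph of an automorphism is a strong
-- bisimulation. Conversely, if two vertices 0 and 1 agree in priority and owner
-- and 0 is the only successor of each, the full relation is a strong
-- bisimulation, but only 0 has a self-loop, so no automorphism maps 1 to 0.

module _ (G : ParityGame) where
  open ParityGame G

  -- The second disjunct is there because the graph of `f` alone is symmetric only if `f` is an
  -- involution.
  SymGraph : (V → V) → Rel V 0ℓ
  SymGraph f u u′ = f u ≡ u′ ⊎ f u′ ≡ u

  symGraph-isStrongBisimulation :
    (φ : V ⤖ V) → IsAutomorphism G (Bijection.to φ) →
    IsStrongBisimulation G (SymGraph (Bijection.to φ))
  symGraph-isStrongBisimulation φ aut = record
    { isGovernedBisimulation = record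
      { symmetric = swap
      ; priority  = λ { (inj₁ refl) → A.priority _
                      ; (inj₂ refl) → sym (A.priority _) }
      -- Vacuous: related vertices always have the same owner.
      ; governed  = λ r 𝒫≢ → contradiction (same-player r) 𝒫≢
      ; transfer  = transfer
      }
    ; player = same-player
    }
    where
    module A = IsAutomorphism aut
    open Bijection φ using (to; strictlySurjective)

    same-player : ∀ {v w} → SymGraph to v w → 𝒫 v ≡ 𝒫 w
    same-player (inj₁ refl) = A.player _
    same-player (inj₂ refl) = sym (A.player _)

    transfer : ∀ {v w} → SymGraph to v w →
               ∀ v′ → v ⟶ v′ → ∃ λ w′ → w ⟶ w′ × SymGraph to v′ w′
    transfer (inj₁ refl) v′ v⟶v′ =
      to v′ , Equivalence.to (A.edge _ v′) v⟶v′ , inj₁ refl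
    -- Here `v` is the image of `w`, so the move is pulled back: surjectivity yields a preimage `w′`
    -- of `v′`, and automorphisms reflect edges.
    transfer (inj₂ refl) v′ v⟶v′ with strictlySurjective v′
    ... | w′ , refl = w′ , Equivalence.from (A.edge _ w′) v⟶v′ , inj₂ refl

  isomorphic⇒stronglyBisimilar :
    ∀ v w → Isomorphic G v w → StronglyBisimilar G v w
  isomorphic⇒stronglyBisimilar v w (φ , aut , φv≡w) =
    SymGraph (Bijection.to φ) , symGraph-isStrongBisimulation φ aut , inj₁ φv≡w

sinkGame : ParityGame
sinkGame = record
  { V      = Fin 2
  ; finite = 2 , ⤖-id (Fin 2)
  ; _⟶_    = λ _ w → w ≡ zero
  ; total  = λ _ → zero , refl
  ; Ω      = const 0
  ; 𝒫      = const ◇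
  }

sinkGame-stronglyBisimilar : ∀ v w → StronglyBisimilar sinkGame v w
sinkGame-stronglyBisimilar v w = (λ _ _ → ⊤) , record
  { isGovernedBisimulation = record
    { symmetric = λ _ → tt
    ; priority  = λ _ → refl
    ; governed  = λ _ _ _ _ _ _ → tt
    ; transfer  = λ _ _ _ → zero , refl , tt
    }
  ; player = λ _ → refl
  } , tt

sinkGame-¬isomorphic : ¬ Isomorphic sinkGame (suc zero) zero
sinkGame-¬isomorphic (φ , aut , φ1≡0)
  -- Since an edge into a vertex is a proof that it equals `zero`, `φ1≡0` is itself a self-loop at
  -- the image of `suc zero`. Reflecting it gives a self-loop at `suc zero`, that is,
  -- `suc zero ≡ zero`.
  with () ← Equivalence.from (IsAutomorphism.edge aut (suc zero) (suc zero)) φ1≡0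

theorem18 : (∀ (G : ParityGame) (v w : ParityGame.V G) →
    Isomorphic G v w → StronglyBisimilar G v w)
    ×
    (∃ λ (G : ParityGame) → ∃₂ λ (v w : ParityGame.V G) →
    StronglyBisimilar G v w × ¬ Isomorphic G v w)
theorem18 =
  isomorphic⇒stronglyBisimilar ,
  sinkGame , suc zero , zero ,
  sinkGame-stronglyBisimilar (suc zero) zero , sinkGame-¬isomorphic
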